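{- Let $p$ be a prime and let $K/F$ be a cyclic Galois extension of degree $p^n$, $n\ge 1$, with $\operatorname{char}F\neq p$ and with $F$ containing a primitive $p$th root of unity $\xi_p$. Let $\sigma$ be a generator of $\operatorname{Gal}(K/F)$ and let $A(K/F)=(K/F,\sigma,\xi_p)$. Then $$\operatorname{ind}A(K/F)\le p^{m(K/F)+1},$$ where for $m(K/F)=-\infty$ the right-hand side is interpreted as $1$.
   Context: Let $p$ be a prime and $K/F$ a cyclic Galois extension of degree $p^n$, $n\ge 1$, with $\operatorname{char}F\ne p$ and $F$ containing a primitive $p$th root of unity $\xi_p$. For $0\le i\le n$ let $K_i$ be the unique intermediate field $F\subseteq K_i\subseteq K$ with $[K_i:F]=p^i$. Define $$m(K/F)=\begin{cases}-\infty, & \xi_p\in N_{K/F}(K^\times),\\ \min\{s\in\{0,\dots,n\} : \xi_p\in N_{K/K_s}(K^\times)\}-1, & \xi_p\notin N_{K/F}(K^\times).\end{cases}$$ For a cyclic extension $L/E$ of degree $r>1$ with $\operatorname{Gal}(L/E)=\langle\tau\rangle$ and $b\in E^\times$, the cyclic algebra $(L/E,\tau,b)$ is the central simple $E$-algebra $\bigoplus_{0\le j<r}u^jL$ with $u^{ -1}du=\tau(d)$ for all $d\in L$ and $u^r=b$. If $B$ is a central simple $E$-algebra with $B\simeq M_s(D)$, $D$ a division algebra, its Schur index is $\operatorname{ind}B=\sqrt{\dim_E D}$. -}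

module Defs where

open import Algebra.Bundles using (CommutativeRing; Ring; RawRing)
import Algebra.Definitions as AlgebraDefinitions
import Algebra.Definitions.RawMonoid as RawMonoidDefinitions
import Algebra.Definitions.RawSemiring as RawSemiringDefinitions
open import Algebra.Morphism.Structures using (IsRingHomomorphism; IsRingIsomorphism)
open import Data.Bool.Base using (if_then_else_)
open import Data.Fin.Base as Fin using (Fin; toℕ)
open import Data.Fin.Properties using (_≟_)
open import Data.Nat.Base as ℕ using (ℕ; suc; _<_)
open import Data.Nat.Divisibility using (_∣_)
open import Data.Product.Base using (Σ; ∃; ∃-syntax; _×_)
open import Function.Bundles using (Bijection; _⇔_)
import Function.Endo.Propositional as Endo
open import Level using (Level; _⊔_) renaming (suc to lsuc)
open import Relation.Binary.Bundles using (Setoid)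
open import Relation.Binary.PropositionalEquality.Core using (_≡_)
import Relation.Binary.PropositionalEquality.Properties as ≡
open import Relation.Nullary.Construct.Add.Infimum using (_₋; ⊥₋; [_])
open import Relation.Nullary.Decidable.Core using (⌊_⌋)
open import Relation.Nullary.Negation.Core using (¬_)

private
  variable
    c ℓ : Level

record IsDivisionRing (R : Ring c ℓ) : Set (c ⊔ ℓ) where
  open Ring R
  open AlgebraDefinitions _≈_ using (Invertible)
  field
    0≉1        : ¬ (0# ≈ 1#)
    invertible : ∀ x → ¬ (x ≈ 0#) → Invertible 1# _*_ x

record Field (c ℓ : Level) : Set (lsuc (c ⊔ ℓ)) where
  field
    commutativeRing : CommutativeRing c ℓ

  open CommutativeRing commutativeRing public

  field
    isDivisionRing : IsDivisionRing ring

module _ (F : Field c ℓ) where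
  open Field F
  open RawMonoidDefinitions +-rawMonoid using () renaming (_×_ to _·_)
  open RawSemiringDefinitions (RawRing.rawSemiring rawRing) using (_^_)

  -- q generates the kernel of ℤ → F; in particular q = 0 is characteristic zero.
  HasCharacteristic : ℕ → Set ℓ
  HasCharacteristic q = ∀ k → (k · 1# ≈ 0#) ⇔ (q ∣ k)

  IsPrimitiveRoot : ℕ → Carrier → Set ℓ
  IsPrimitiveRoot p ξ = (ξ ^ p ≈ 1#) × (∀ k → 0 < k → k < p → ¬ (ξ ^ k ≈ 1#))

-- Unital associative algebras over a field F, the scalars being given by a
-- ring homomorphism from F to the centre.
record Algebra (F : Field c ℓ) : Set (lsuc (c ⊔ ℓ)) where
  private module F = Field F
  field
    ring : Ring c ℓ

  open Ring ring public

  field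
    ι                : F.Carrier → Carrier
    ι-isHomomorphism : IsRingHomomorphism F.rawRing rawRing ι
    ι-central        : ∀ f a → ι f * a ≈ a * ι f

module _ {F : Field c ℓ} (A : Algebra F) where
  private module F = Field F
  open Algebra A
  open RawMonoidDefinitions +-rawMonoid using (sum)

  -- dim_F A = n.
  record HasDimension (n : ℕ) : Set (c ⊔ ℓ) where
    field
      basis       : Fin n → Carrier
      spanning    : ∀ a → Σ (Fin n → F.Carrier) λ k → a ≈ sum (λ i → ι (k i) * basis i)
      independent : ∀ (k : Fin n → F.Carrier) → sum (λ i → ι (k i) * basis i) ≈ 0# →
                    ∀ i → k i F.≈ F.0#

-- A field extension K/F, given by its (automatically injective) embedding.
record Extension (F K : Field c ℓ) : Set (c ⊔ ℓ) where
  private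
    module F = Field F
    module K = Field K
  field
    ι                : F.Carrier → K.Carrier
    ι-isHomomorphism : IsRingHomomorphism F.rawRing K.rawRing ι

  algebra : Algebra F
  algebra = record
    { ring             = K.ring
    ; ι                = ι
    ; ι-isHomomorphism = ι-isHomomorphism
    ; ι-central        = λ f a → K.*-comm (ι f) a
    }

HasDegree : {F K : Field c ℓ} → Extension F K → ℕ → Set (c ⊔ ℓ)
HasDegree K/F n = HasDimension (Extension.algebra K/F) n

-- F ⊆ L ⊆ K, with inclusions rendered as compatible embeddings.
record IntermediateField {F K : Field c ℓ} (K/F : Extension F K) : Set (lsuc (c ⊔ ℓ)) where
  field
    L        : Field c ℓ
    lower    : Extension F L
    upper    : Extension L K
    commutes : ∀ f → Field._≈_ K (Extension.ι upper (Extension.ι lower f))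
                                 (Extension.ι K/F f)

module _ {F K : Field c ℓ} (K/F : Extension F K) where
  private module F = Field F
  open Field K
  open Extension K/F using (ι)

  record Automorphism : Set (c ⊔ ℓ) where
    field
      map           : Carrier → Carrier
      isIsomorphism : IsRingIsomorphism rawRing rawRing map
      fixes         : ∀ f → map (ι f) ≈ ι f

  open Automorphism

  Gal : Setoid (c ⊔ ℓ) (c ⊔ ℓ)
  Gal = record
    { Carrier       = Automorphism
    ; _≈_           = λ σ τ → ∀ x → map σ x ≈ map τ x
    ; isEquivalence = record
      { refl  = λ _ → refl
      ; sym   = λ σ≈τ x → sym (σ≈τ x)
      ; trans = λ σ≈τ τ≈υ x → trans (σ≈τ x) (τ≈υ x)
      }
    }

  GalEnumeration : ℕ → Set (c ⊔ ℓ)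
  GalEnumeration r = Bijection (≡.setoid (Fin r)) Gal

  -- K/F is a finite Galois extension of degree r: |Aut(K/F)| = [K : F] = r.
  record IsGalois (r : ℕ) : Set (c ⊔ ℓ) where
    field
      degree      : HasDegree K/F r
      enumeration : GalEnumeration r

  -- Used for finite Gal(K/F) only, where nonnegative powers suffice.
  Generates : Automorphism → Set (c ⊔ ℓ)
  Generates σ = ∀ τ → ∃[ k ] (∀ x → map τ x ≈ (map σ ^ k) x)
    where open Endo Carrier using (_^_)

  norm : ∀ {r} → GalEnumeration r → Carrier → Carrier
  norm e x = product (λ i → map (Bijection.to e i) x)
    where open RawMonoidDefinitions *-rawMonoid using () renaming (sum to product)

  -- a ∈ N_{K/F}(K^×), for K/F finite Galois: the norm is the product of the
  -- Galois conjugates.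
  IsNorm : F.Carrier → Set (c ⊔ ℓ)
  IsNorm a = ∃[ r ] Σ (GalEnumeration r) λ e →
             ∃[ x ] (¬ (x ≈ 0#)) × (ι a ≈ norm e x)

IsMinimum : ∀ {n p} → (Fin n → Set p) → Fin n → Set p
IsMinimum P s = P s × (∀ t → P t → s Fin.≤ t)

-- m(K/F) ≡ m, where Kₛ is the intermediate field of degree pˢ and ⊥₋ is -∞.
-- When ξ ∉ N_{K/F}(K^×) the minimum s is positive (K₀ = F), so m = s - 1 is a
-- natural number.
Is-m : {F K : Field c ℓ} (K/F : Extension F K) (ξ : Field.Carrier F) {n : ℕ} →
       (Fin (suc n) → IntermediateField K/F) → ℕ ₋ → Set (c ⊔ ℓ)
Is-m K/F ξ K⟨_⟩ ⊥₋    = IsNorm K/F ξ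
Is-m K/F ξ K⟨_⟩ [ m ] =
  ¬ IsNorm K/F ξ ×
  ∃[ s ] IsMinimum (λ t → IsNorm (upper K⟨ t ⟩) (Extension.ι (lower K⟨ t ⟩) ξ)) s ×
         toℕ s ≡ suc m
  where open IntermediateField

_^[_+1] : ℕ → ℕ ₋ → ℕ
p ^[ ⊥₋    +1] = 1
p ^[ [ m ] +1] = p ℕ.^ suc m

-- The cyclic algebra (L/E, τ, b) = ⊕_{0≤j<r} uʲL with u⁻¹du = τ(d) and uʳ = b,
-- where r = [L : E].  These data determine it up to isomorphism of E-algebras.
record CyclicAlgebra {E L : Field c ℓ} (L/E : Extension E L) (r : ℕ)
                     (τ : Automorphism L/E) (b : Field.Carrier E) :
                     Set (lsuc (c ⊔ ℓ)) where
  private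
    module E = Field E
    module L = Field L
  field
    algebra : Algebra E

  open Algebra algebra public
  open RawMonoidDefinitions +-rawMonoid using (sum)
  open RawSemiringDefinitions (RawRing.rawSemiring rawRing) using (_^_)

  field
    κ                : L.Carrier → Carrier
    κ-isHomomorphism : IsRingHomomorphism L.rawRing rawRing κ
    κ-linear         : ∀ f → κ (Extension.ι L/E f) ≈ ι f
    u u⁻¹            : Carrier
    u⁻¹*u            : u⁻¹ * u ≈ 1#
    u*u⁻¹            : u * u⁻¹ ≈ 1#
    conjugation      : ∀ d → u⁻¹ * κ d * u ≈ κ (Automorphism.map τ d)
    u^r              : u ^ r ≈ ι b
    spanning         : ∀ a → Σ (Fin r → L.Carrier) λ d → a ≈ sum (λ j → u ^ toℕ j * κ (d j))
    independent      : ∀ (d : Fin r → L.Carrier) → sum (λ j → u ^ toℕ j * κ (d j)) ≈ 0# →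
                       ∀ j → d j L.≈ L.0#

module _ {F : Field c ℓ} where

  scalarMatrix : (D : Algebra F) (s : ℕ) → Algebra.Carrier D →
                 Fin s → Fin s → Algebra.Carrier D
  scalarMatrix D s a i j = if ⌊ i ≟ j ⌋ then a else Algebra.0# D

  matrixRing : (D : Algebra F) (s : ℕ) → RawRing c ℓ
  matrixRing D s = record
    { Carrier = Fin s → Fin s → Carrier
    ; _≈_     = λ M N → ∀ i j → M i j ≈ N i j
    ; _+_     = λ M N i j → M i j + N i j
    ; _*_     = λ M N i j → sum (λ k → M i k * N k j)
    ; -_      = λ M i j → - M i j
    ; 0#      = λ _ _ → 0#
    ; 1#      = scalarMatrix D s 1#
    }
    where
    open Algebra D
    open RawMonoidDefinitions +-rawMonoid using (sum)

  -- B ≃ Mₛ(D) as F-algebras.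
  record _≃M[_]_ (B : Algebra F) (s : ℕ) (D : Algebra F) : Set (c ⊔ ℓ) where
    private
      module B = Algebra B
      module D = Algebra D
      module M = RawRing (matrixRing D s)
    field
      to            : B.Carrier → M.Carrier
      isIsomorphism : IsRingIsomorphism B.rawRing (matrixRing D s) to
      linear        : ∀ f → to (B.ι f) M.≈ scalarMatrix D s (D.ι f)

  -- ind B ≡ d for a central simple F-algebra B; d = √(dim_F D) is expressed as
  -- dim_F D = d².
  IsIndex : Algebra F → ℕ → Set (lsuc (c ⊔ ℓ))
  IsIndex B d = ∃[ s ] Σ (Algebra F) λ D →
    (B ≃M[ s ] D) × IsDivisionRing (Algebra.ring D) × HasDimension D (d ℕ.* d)

{-# OPTIONS --safe #-}

-- Let N = pⁿ, let L = Kₛ with ξ a norm from K to L, and let q be the least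
-- positive number such that σ^q fixes L.  Then Gal(K/L) is generated by
-- τ = σ^q and has m = N/q elements, so that ξ = x · τx ⋯ τᵐ⁻¹x.  By Dedekind's
-- independence of characters, the q distinct embeddings of L into K given by
-- 1, σ, …, σ^(q-1) are independent, whence q ≤ [L : F].
--
-- In A, put v = u^q, so vᵐ = ξ and d v = v τ(d) for d ∈ K.  The element
-- e = Σ_{j<m} vʲ τʲ⁺¹x ⋯ τᵐ⁻¹x is nonzero, and (x - v) e telescopes to
-- N(x) - vᵐ = 0.  So v e = x e, and the left ideal A e = Σ_{j<q} uʲ K e has
-- dimension at most q N over F.  If A ≃ Mₜ(D) with dim D = d², a nonzero left
-- ideal has dimension at least t d²; as N ≤ t d, this gives d ≤ q ≤ [L : F].
--
-- Equality in a field is not assumed decidable; ranks and least elements are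
-- found under ¬ ¬, which is harmless because d ≤ [L : F] is decidable.

module Submission where

open import Defs
open import Algebra.Bundles using (CommutativeMonoid; Semiring)
import Algebra.Morphism.Construct.Composition as Composition
import Algebra.Morphism.Construct.Identity as Identity
import Algebra.Properties.Group as GroupProperties
import Algebra.Properties.CommutativeMonoid.Sum as CommutativeMonoidSum
import Algebra.Properties.Semiring.Sum as SemiringSum
import Algebra.Properties.Semiring.Exp as SemiringExp
import Algebra.Definitions.RawSemiring as RawSemiringDefinitions
open import Algebra.Morphism.Structures using (IsMonoidHomomorphism; IsRingHomomorphism; IsRingIsomorphism)
import Algebra.Properties.Ring as RingProperties
open import Data.Bool.Base using (if_then_else_)
open import Data.Fin.Base as Fin using (Fin; zero; suc; toℕ; fromℕ<; punchIn; combine; remQuot; _↑ˡ_; _↑ʳ_)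
open import Data.Fin.Permutation using (Permutation; permutation)
import Data.Fin.Properties as Fin
open import Data.Nat.Base as ℕ using (ℕ; zero; suc; s≤s; _≤_; _<_; _^_; NonZero)
open import Data.Nat.DivMod using (_/_; _%_; m≡m%n+[m/n]*n; m%n<n)
open import Data.Nat.Divisibility using (_∣_; divides; m%n≡0⇒n∣m)
open import Data.Nat.Induction using (<-rec)
open import Data.Nat.Primality using (Prime; prime⇒nonZero)
import Data.Nat.Properties as ℕ
open import Data.Product.Base using (∃; ∃-syntax; _×_; _,_; proj₁; proj₂; uncurry)
open import Data.Vec.Functional using (insertAt)
open import Data.Vec.Functional.Properties using (insertAt-lookup; insertAt-punchIn)
open import Function.Base using (_∘_)
open import Function.Bundles using (Bijection)
import Function.Endo.Propositional as Endo
open import Level using (Level; _⊔_)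
open import Relation.Binary.Definitions using (tri<; tri≈; tri>)
open import Relation.Binary.PropositionalEquality.Core as ≡ using (_≡_; _≢_)
import Relation.Binary.Reasoning.Setoid as SetoidReasoning
open import Relation.Nullary.Construct.Add.Infimum using (⊥₋; [_])
open import Relation.Nullary.Negation.Core using (¬_; contradiction)
open import Relation.Nullary.Decidable.Core using (yes; no; ⌊_⌋; decidable-stable)

private
  variable
    a b c ℓ : Level

-- Double negation over finite index sets

¬¬-∀ : ∀ {n} {P : Fin n → Set a} → (∀ i → ¬ ¬ P i) → ¬ ¬ (∀ i → P i)
¬¬-∀ {n = zero}  ¬¬P ¬∀P = ¬∀P λ ()
¬¬-∀ {n = suc n} ¬¬P ¬∀P =
  ¬¬P zero λ P₀ → ¬¬-∀ (¬¬P ∘ suc) λ P₊ → ¬∀P λ { zero → P₀ ; (suc i) → P₊ i }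

-- Used to pick a nonzero entry of a vector or matrix without deciding equality, whenever the goal
-- is itself a negation.
¬∀⇒¬¬∃¬ : ∀ {n} {P : Fin n → Set a} → ¬ (∀ i → P i) → ¬ ¬ (∃[ i ] ¬ P i)
¬∀⇒¬¬∃¬ ¬∀P ¬∃¬P = ¬¬-∀ (λ i ¬Pᵢ → ¬∃¬P (i , ¬Pᵢ)) ¬∀P

if-≟-yes : ∀ {n} {A : Set a} (i : Fin n) {x y : A} → (if ⌊ i Fin.≟ i ⌋ then x else y) ≡ x
if-≟-yes i with i Fin.≟ i
... | yes _  = ≡.refl
... | no i≢i = contradiction ≡.refl i≢i

if-≟-no : ∀ {n} {A : Set a} {i j : Fin n} {x y : A} → i ≢ j → (if ⌊ i Fin.≟ j ⌋ then x else y) ≡ y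
if-≟-no {i = i} {j} i≢j with i Fin.≟ j
... | yes i≡j = contradiction i≡j i≢j
... | no _    = ≡.refl

-- Finite sums in commutative monoids

module Sums (M : CommutativeMonoid c ℓ) where
  open CommutativeMonoid M
  open CommutativeMonoidSum M

  sum-zero : ∀ {n} (f : Fin n → Carrier) → (∀ i → f i ≈ ε) → sum f ≈ ε
  sum-zero {n} f f≈0 = trans (sum-cong-≋ {n} f≈0) (sum-replicate-zero n)

  sum-single : ∀ {n} (k : Fin n) (f : Fin n → Carrier) →
               (∀ i → i ≢ k → f i ≈ ε) → sum f ≈ f k
  sum-single {suc n} k f f≈0 = trans (sum-remove {i = k} f)
    (trans (∙-congˡ (sum-zero {n} _ (λ i → f≈0 (punchIn k i) (Fin.punchInᵢ≢i k i)))) (identityʳ _))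

  sum-↑ : ∀ m {n} (f : Fin (m ℕ.+ n) → Carrier) →
          sum f ≈ sum (λ i → f (i ↑ˡ n)) ∙ sum (λ j → f (m ↑ʳ j))
  sum-↑ zero    f = sym (identityˡ _)
  sum-↑ (suc m) f = trans (∙-congˡ (sum-↑ m (f ∘ suc))) (sym (assoc _ _ _))

  sum-combine : ∀ m n (f : Fin (m ℕ.* n) → Carrier) →
                sum f ≈ sum {m} (λ i → sum {n} (λ j → f (combine i j)))
  sum-combine zero    n f = refl
  sum-combine (suc m) n f =
    trans (sum-↑ n f) (∙-congˡ (sum-combine m n (λ i → f (n ↑ʳ i))))

module _ {M : CommutativeMonoid a b} {N : CommutativeMonoid c ℓ} where
  private
    module M = CommutativeMonoid M
    module N = CommutativeMonoid N
  open CommutativeMonoidSum using (sum)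

  sum-homo : ∀ {f} → IsMonoidHomomorphism M.rawMonoid N.rawMonoid f →
             ∀ {n} (x : Fin n → M.Carrier) → f (sum M x) N.≈ sum N (f ∘ x)
  sum-homo f-homo {zero}  x = IsMonoidHomomorphism.ε-homo f-homo
  sum-homo f-homo {suc n} x =
    N.trans (IsMonoidHomomorphism.homo f-homo _ _) (N.∙-congˡ (sum-homo f-homo (x ∘ suc)))

-- Underdetermined homogeneous linear systems

module Kernel (F : Field c ℓ) where
  open Field F hiding (zero)
  open IsDivisionRing isDivisionRing
  open SemiringSum semiring
  open Sums +-commutativeMonoid
  open SetoidReasoning setoid
  open RingProperties ring using (-‿distribˡ-*)

  InKernel : ∀ {m n} → (Fin m → Fin n → Carrier) → (Fin n → Carrier) → Set ℓ
  InKernel A x = ∀ i → sum (λ j → A i j * x j) ≈ 0#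

  Nontrivial : ∀ {n} → (Fin n → Carrier) → Set ℓ
  Nontrivial x = ∃[ j ] ¬ (x j ≈ 0#)

  private
    module Eliminate {m n} (A : Fin (suc m) → Fin (suc n) → Carrier)
                     (k : Fin (suc n)) (r : Carrier) (r*pivot : r * A zero k ≈ 1#) where

      -- The Schur complement of the pivot `A zero k`, whose inverse is `r`.
      reduced : Fin m → Fin n → Carrier
      reduced i j = A (suc i) (punchIn k j) - A (suc i) k * r * A zero (punchIn k j)

      module _ (x : Fin n → Carrier) (Ax≈0 : InKernel reduced x) where
        s : Carrier
        s = sum (λ j → A zero (punchIn k j) * x j)

        -- The inserted coordinate is forced by row `zero`: it solves `A zero k * y + s ≈ 0#`.
        extended : Fin (suc n) → Carrier
        extended = insertAt x k (- (r * s))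

        expand : ∀ i → sum (λ j → A i j * extended j) ≈
                       A i k * - (r * s) + sum (λ j → A i (punchIn k j) * x j)
        expand i = begin
          sum (λ j → A i j * extended j)
            ≈⟨ sum-remove {i = k} (λ j → A i j * extended j) ⟩
          A i k * extended k + sum (λ j → A i (punchIn k j) * extended (punchIn k j))
            ≈⟨ +-cong (*-congˡ (reflexive (insertAt-lookup x k _)))
                      (sum-cong-≋ {n} (λ j → *-congˡ (reflexive (insertAt-punchIn x k _ j)))) ⟩
          A i k * - (r * s) + sum (λ j → A i (punchIn k j) * x j) ∎

        inKernel : InKernel A extended
        inKernel zero = trans (expand zero) (begin
          A zero k * - (r * s) + s   ≈⟨ +-congʳ (*-congˡ (-‿distribˡ-* r s)) ⟩
          A zero k * (- r * s) + s   ≈⟨ +-congʳ (sym (*-assoc _ _ _)) ⟩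
          A zero k * - r * s + s     ≈⟨ +-congʳ (*-congʳ (trans (*-comm _ _) (sym (-‿distribˡ-* r _)))) ⟩
          - (r * A zero k) * s + s   ≈⟨ +-cong (*-congʳ (-‿cong r*pivot)) (sym (*-identityˡ s)) ⟩
          - 1# * s + 1# * s          ≈⟨ sym (distribʳ s (- 1#) 1#) ⟩
          (- 1# + 1#) * s            ≈⟨ *-congʳ (-‿inverseˡ 1#) ⟩
          0# * s                     ≈⟨ zeroˡ s ⟩
          0# ∎)
        -- Substituting the inserted coordinate turns row `suc i` of `A` into row `i` of `reduced`.
        inKernel (suc i) = trans (expand (suc i)) (begin
          A (suc i) k * - (r * s) + sum (λ j → A (suc i) (punchIn k j) * x j)
            ≈⟨ +-congʳ (begin
              A (suc i) k * - (r * s)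
                ≈⟨ *-congˡ (-‿distribˡ-* r s) ⟩
              A (suc i) k * (- r * s)
                ≈⟨ sym (*-assoc _ _ _) ⟩
              A (suc i) k * - r * s
                ≈⟨ *-congʳ (trans (*-comm _ _) (trans (sym (-‿distribˡ-* r _)) (-‿cong (*-comm _ _)))) ⟩
              - (A (suc i) k * r) * s
                ≈⟨ *-distribˡ-sum {n} _ _ ⟩
              sum (λ j → - (A (suc i) k * r) * (A zero (punchIn k j) * x j)) ∎) ⟩
          sum (λ j → - (A (suc i) k * r) * (A zero (punchIn k j) * x j)) +
          sum (λ j → A (suc i) (punchIn k j) * x j)
            ≈⟨ sym (∑-distrib-+ {n} _ _) ⟩
          sum (λ j → - (A (suc i) k * r) * (A zero (punchIn k j) * x j) +
                     A (suc i) (punchIn k j) * x j)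
            ≈⟨ sum-cong-≋ {n} (λ j → begin
              - (A (suc i) k * r) * (A zero (punchIn k j) * x j) + A (suc i) (punchIn k j) * x j
                ≈⟨ +-congʳ (trans (sym (*-assoc _ _ _)) (*-congʳ (sym (-‿distribˡ-* _ _)))) ⟩
              - (A (suc i) k * r * A zero (punchIn k j)) * x j + A (suc i) (punchIn k j) * x j
                ≈⟨ sym (distribʳ _ _ _) ⟩
              (- (A (suc i) k * r * A zero (punchIn k j)) + A (suc i) (punchIn k j)) * x j
                ≈⟨ *-congʳ (+-comm _ _) ⟩
              reduced i j * x j ∎) ⟩
          sum (λ j → reduced i j * x j)
            ≈⟨ Ax≈0 i ⟩
          0# ∎)

  -- Gaussian elimination by induction on the number of rows. Existence is doubly negated because
  -- finding a pivot would require deciding equality with zero.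
  kernel : ∀ {m n} → m < n → (A : Fin m → Fin n → Carrier) →
           ¬ ¬ (∃[ x ] Nontrivial x × InKernel A x)
  kernel {zero} {suc n} _ A ¬∃ =
    ¬∃ ((λ _ → 1#) , (zero , λ 1≈0 → 0≉1 (sym 1≈0)) , λ ())
  kernel {suc m} {suc n} (s≤s m<n) A ¬∃ =
    ¬∀⇒¬¬∃¬ nonzeroRow λ (k , pivot≉0) →
      let r , r*pivot , _ = invertible (A zero k) pivot≉0
          open Eliminate A k r r*pivot
      in kernel m<n reduced λ (x , (j , xⱼ≉0) , Ax≈0) →
        ¬∃ ( extended x Ax≈0
           , (punchIn k j , λ y≈0 → xⱼ≉0 (trans (sym (reflexive (insertAt-punchIn x k _ j))) y≈0))
           , inKernel x Ax≈0)
    where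
    -- A vanishing first row imposes no condition, so a solution for the other rows would already
    -- do.
    nonzeroRow : ¬ (∀ j → A zero j ≈ 0#)
    nonzeroRow A₀≈0 = kernel (ℕ.m<n⇒m<1+n m<n) (A ∘ suc) λ (x , x≉0 , Ax≈0) →
      ¬∃ (x , x≉0 , λ { zero    → sum-zero {suc n} _ (λ j → trans (*-congʳ (A₀≈0 j)) (zeroˡ (x j)))
                      ; (suc i) → Ax≈0 i })

-- Independence of characters

module Dedekind (K : Field c ℓ) {X : Set a} (_·_ : X → X → X) (1ₓ : X) where
  open Field K hiding (zero)
  open IsDivisionRing isDivisionRing
  open SemiringSum semiring
  open Sums +-commutativeMonoid
  open GroupProperties +-group using () renaming (x∙y⁻¹≈ε⇒x≈y to x-y≈0⇒x≈y)
  open SetoidReasoning setoid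

  -- Values are taken in the whole multiplicative monoid of `K`, zero included, so that field
  -- embeddings qualify on all of their domain.
  record IsCharacter (χ : X → Carrier) : Set (a ⊔ ℓ) where
    field
      ·-homo : ∀ x y → χ (x · y) ≈ χ x * χ y
      1-homo : χ 1ₓ ≈ 1#

  open IsCharacter

  -- Pointwise equality is negated in its double-negated form because
  -- ∀ x → ¬ ¬ P x does not yield ¬ ¬ ∀ x → P x for infinite X.
  Distinct : ∀ {n} → (Fin n → X → Carrier) → Set (a ⊔ ℓ)
  Distinct χ = ∀ i j → i ≢ j → ¬ (∀ x → ¬ ¬ (χ i x ≈ χ j x))

  -- Induction on the number of characters. Subtracting `χ zero x` times the relation at `y` from
  -- the relation at `x · y` eliminates `χ zero` and leaves coefficients `a i * (χ i x - χ zero x)`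
  -- on the others.
  characters-independent :
    ∀ {n} (χ : Fin n → X → Carrier) → (∀ i → IsCharacter (χ i)) → Distinct χ →
    ∀ (a : Fin n → Carrier) → (∀ x → sum (λ i → a i * χ i x) ≈ 0#) → ∀ i → ¬ ¬ (a i ≈ 0#)
  characters-independent {suc n} χ isχ χ-distinct a aχ≈0 = λ
    -- Once all other coefficients vanish, the relation at `1ₓ` reads `a zero ≈ 0#`.
    { zero    ¬a₀≈0 → ¬¬-∀ tail≈0 λ a₊≈0 → ¬a₀≈0 (begin
        a zero
          ≈⟨ sym (*-identityʳ _) ⟩
        a zero * 1#
          ≈⟨ *-congˡ (sym (1-homo (isχ zero))) ⟩
        a zero * χ zero 1ₓ
          ≈⟨ sym (+-identityʳ _) ⟩
        a zero * χ zero 1ₓ + 0#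
          ≈⟨ +-congˡ (sym (sum-zero {n} _ (λ i → trans (*-congʳ (a₊≈0 i)) (zeroˡ _)))) ⟩
        sum (λ i → a i * χ i 1ₓ)
          ≈⟨ aχ≈0 1ₓ ⟩
        0# ∎)
    ; (suc i) → tail≈0 i
    }
    where
    reduced≈0 : ∀ x y → sum (λ i → a (suc i) * (χ (suc i) x - χ zero x) * χ (suc i) y) ≈ 0#
    reduced≈0 x y = begin
      sum (λ i → a (suc i) * (χ (suc i) x - χ zero x) * χ (suc i) y)
        ≈⟨ sym (+-identityˡ _) ⟩
      0# + sum (λ i → a (suc i) * (χ (suc i) x - χ zero x) * χ (suc i) y)
        -- The term of `χ zero` may be restored, as its factor `χ zero x - χ zero x` is zero.
        ≈⟨ +-congʳ (sym (trans (*-congʳ (trans (*-congˡ (-‿inverseʳ _)) (zeroʳ _))) (zeroˡ _))) ⟩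
      sum (λ i → a i * (χ i x - χ zero x) * χ i y)
        ≈⟨ sum-cong-≋ {suc n} (λ i → begin
          a i * (χ i x - χ zero x) * χ i y
            ≈⟨ *-congʳ (distribˡ _ _ _) ⟩
          (a i * χ i x + a i * - χ zero x) * χ i y
            ≈⟨ distribʳ _ _ _ ⟩
          a i * χ i x * χ i y + a i * - χ zero x * χ i y
            ≈⟨ +-cong (trans (*-assoc _ _ _) (*-congˡ (sym (·-homo (isχ i) x y))))
                      (trans (*-congʳ (*-comm _ _)) (*-assoc _ _ _)) ⟩
          a i * χ i (x · y) + - χ zero x * (a i * χ i y) ∎) ⟩
      sum (λ i → a i * χ i (x · y) + - χ zero x * (a i * χ i y))
        ≈⟨ ∑-distrib-+ (λ i → a i * χ i (x · y)) (λ i → - χ zero x * (a i * χ i y)) ⟩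
      sum (λ i → a i * χ i (x · y)) + sum (λ i → - χ zero x * (a i * χ i y))
        ≈⟨ +-cong (aχ≈0 (x · y)) (sym (*-distribˡ-sum (- χ zero x) (λ i → a i * χ i y))) ⟩
      0# + - χ zero x * sum (λ i → a i * χ i y)
        ≈⟨ trans (+-identityˡ _) (trans (*-congˡ (aχ≈0 y)) (zeroʳ _)) ⟩
      0# ∎

    tail≈0 : ∀ i → ¬ ¬ (a (suc i) ≈ 0#)
    -- If `a (suc i)` is nonzero, it can be cancelled from the shorter relation for every `x`, so
    -- the two characters agree everywhere up to double negation.
    tail≈0 i ¬aᵢ≈0 = χ-distinct (suc i) zero (λ ()) λ x χᵢx≉χ₀x →
      characters-independent (χ ∘ suc) (isχ ∘ suc)
        (λ j k j≢k → χ-distinct (suc j) (suc k) (j≢k ∘ Fin.suc-injective))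
        (λ j → a (suc j) * (χ (suc j) x - χ zero x)) (reduced≈0 x) i λ aᵢΔ≈0 →
        let r , r*aᵢ , _ = invertible _ ¬aᵢ≈0 in
        χᵢx≉χ₀x (x-y≈0⇒x≈y _ _ (begin
          χ (suc i) x - χ zero x                     ≈⟨ sym (*-identityˡ _) ⟩
          1# * (χ (suc i) x - χ zero x)              ≈⟨ *-congʳ (sym r*aᵢ) ⟩
          r * a (suc i) * (χ (suc i) x - χ zero x)   ≈⟨ *-assoc _ _ _ ⟩
          r * (a (suc i) * (χ (suc i) x - χ zero x)) ≈⟨ *-congˡ aᵢΔ≈0 ⟩
          r * 0#                                     ≈⟨ zeroʳ r ⟩
          0# ∎))

-- Linear algebra in F-algebras

module LinearAlgebra {F : Field c ℓ} (B : Algebra F) where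
  private module F = Field F
  open Algebra B hiding (zero)
  open SemiringSum semiring
  open Sums +-commutativeMonoid
  open SetoidReasoning setoid
  open IsRingHomomorphism ι-isHomomorphism
  open CommutativeMonoidSum F.+-commutativeMonoid using () renaming (sum to sumF)
  open Kernel F

  infix 8 _•_
  _•_ : ∀ {n} → (Fin n → F.Carrier) → (Fin n → Carrier) → Carrier
  x • v = sum (λ i → ι (x i) * v i)

  Independent : ∀ {n} → (Fin n → Carrier) → Set (c ⊔ ℓ)
  Independent v = ∀ x → x • v ≈ 0# → ∀ i → x i F.≈ F.0#

  ι-sum : ∀ {n} (x : Fin n → F.Carrier) → ι (sumF x) ≈ sum (ι ∘ x)
  ι-sum = sum-homo {M = F.+-commutativeMonoid} {N = +-commutativeMonoid} +-isMonoidHomomorphism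

  •-assoc : ∀ {m n} (A : Fin m → Fin n → F.Carrier) (x : Fin n → F.Carrier) (v : Fin m → Carrier) →
            sum (λ j → ι (x j) * (λ i → A i j) • v) ≈ (λ i → sumF (λ j → A i j F.* x j)) • v
  •-assoc {m} {n} A x v = begin
    sum (λ j → ι (x j) * (λ i → A i j) • v)
      ≈⟨ sum-cong-≋ {n} (λ j → *-distribˡ-sum {m} _ _) ⟩
    sum (λ j → sum (λ i → ι (x j) * (ι (A i j) * v i)))
      ≈⟨ ∑-comm {n} {m} _ ⟩
    sum (λ i → sum (λ j → ι (x j) * (ι (A i j) * v i)))
      ≈⟨ sum-cong-≋ {m} (λ i → begin
        sum (λ j → ι (x j) * (ι (A i j) * v i))
          ≈⟨ sum-cong-≋ {n} (λ j → trans (sym (*-assoc _ _ _))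
               (*-congʳ (trans (sym (*-homo _ _)) (⟦⟧-cong (F.*-comm _ _))))) ⟩
        sum (λ j → ι (A i j F.* x j) * v i)
          ≈⟨ sym (*-distribʳ-sum {n} _ _) ⟩
        sum (λ j → ι (A i j F.* x j)) * v i
          ≈⟨ *-congʳ (sym (ι-sum {n} _)) ⟩
        ι (sumF (λ j → A i j F.* x j)) * v i ∎) ⟩
    (λ i → sumF (λ j → A i j F.* x j)) • v ∎

  -- Turns a kernel vector of a coordinate matrix into a linear relation among the elements with
  -- these coordinates.
  •-kernel : ∀ {m n} (A : Fin m → Fin n → F.Carrier) (x : Fin n → F.Carrier) (v : Fin m → Carrier) →
             InKernel A x → sum (λ j → ι (x j) * (λ i → A i j) • v) ≈ 0#
  •-kernel {m} A x v Ax≈0 = trans (•-assoc A x v) (sum-zero {m} _ (λ i →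
    trans (*-congʳ (trans (⟦⟧-cong (Ax≈0 i)) 0#-homo)) (zeroˡ _)))

  -- If `m < n`, the matrix that expresses `w` through `v` has more columns than rows, and a kernel
  -- vector is a nontrivial relation among the `w j`.
  steinitz : ∀ {m n} (w : Fin n → Carrier) → Independent w → (v : Fin m → Carrier) →
             (∀ j → ∃[ x ] w j ≈ x • v) → n ≤ m
  steinitz {m} {n} w w-independent v w-spanned = ℕ.≮⇒≥ λ m<n →
    kernel m<n A λ (x , (j , xⱼ≉0) , Ax≈0) →
      xⱼ≉0 (w-independent x (begin
        x • w
          ≈⟨ sum-cong-≋ {n} (λ j → *-congˡ (proj₂ (w-spanned j))) ⟩
        sum (λ j → ι (x j) * (λ i → A i j) • v)
          ≈⟨ •-kernel A x v Ax≈0 ⟩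
        0# ∎) j)
    where
    A : Fin m → Fin n → F.Carrier
    A i j = proj₁ (w-spanned j) i

-- Dimension and left ideals of matrix algebras

module MatrixAlgebra {F : Field c ℓ} {B D : Algebra F} {t δ} (B≃MD : B ≃M[ t ] D)
                     (D-basis : HasDimension D δ) where
  private
    module F = Field F
    module B = Algebra B
  open Algebra D hiding (zero)
  open SemiringSum semiring
  open Sums +-commutativeMonoid
  open SetoidReasoning setoid
  open LinearAlgebra D using () renaming (_•_ to _•ᴰ_; •-kernel to •ᴰ-kernel)
  open LinearAlgebra B
  open Kernel F
  open _≃M[_]_ B≃MD
  open IsRingIsomorphism isIsomorphism
  open HasDimension D-basis
  open CommutativeMonoidSum B.+-commutativeMonoid using () renaming (sum to sumB)
  open CommutativeMonoidSum F.+-commutativeMonoid using () renaming (sum to sumF)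

  entry-homo : ∀ i j → IsMonoidHomomorphism B.+-rawMonoid +-rawMonoid (λ x → to x i j)
  entry-homo i j = record
    { isMagmaHomomorphism = record
      { isRelHomomorphism = record { cong = λ x≈y → ⟦⟧-cong x≈y i j }
      ; homo              = λ x y → +-homo x y i j
      }
    ; ε-homo = 0#-homo i j
    }

  to-sum : ∀ {n} (x : Fin n → B.Carrier) i j → to (sumB x) i j ≈ sum (λ k → to (x k) i j)
  to-sum x i j = sum-homo {M = B.+-commutativeMonoid} {N = +-commutativeMonoid} (entry-homo i j) x

  to-ι* : ∀ f x i j → to (B.ι f B.* x) i j ≈ ι f * to x i j
  to-ι* f x i j = begin
    to (B.ι f B.* x) i j
      ≈⟨ *-homo _ _ i j ⟩
    sum (λ k → to (B.ι f) i k * to x k j)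
      ≈⟨ sum-single i _ (λ k k≢i → trans
           (*-congʳ (trans (linear f i k) (reflexive (if-≟-no (k≢i ∘ ≡.sym))))) (zeroˡ _)) ⟩
    to (B.ι f) i i * to x i j
      ≈⟨ *-congʳ (trans (linear f i i) (reflexive (if-≟-yes i))) ⟩
    ι f * to x i j ∎

  to-• : ∀ {n} (x : Fin n → F.Carrier) (v : Fin n → B.Carrier) i j →
         to (x • v) i j ≈ sum (λ k → ι (x k) * to (v k) i j)
  to-• {n} x v i j = trans (to-sum {n} _ i j) (sum-cong-≋ {n} (λ k → to-ι* (x k) (v k) i j))

  private
    -- Numbers the F-coordinates of a matrix over `D`: a matrix position together with a basis
    -- element of `D`.
    index : Fin (t ℕ.* t ℕ.* δ) → (Fin t × Fin t) × Fin δ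
    index i = let rs , l = remQuot {t ℕ.* t} δ i in remQuot {t} t rs , l

    index-combine : ∀ r s l → index (combine (combine r s) l) ≡ ((r , s) , l)
    index-combine r s l = ≡.trans
      (≡.cong (λ (rs , l) → remQuot {t} t rs , l) (Fin.remQuot-combine {t ℕ.* t} {δ} (combine r s) l))
      (≡.cong (_, l) (Fin.remQuot-combine {t} {t} r s))

  -- An element of `B` is determined by `t * t * δ` coordinates; with more elements than that, the
  -- coordinate matrix has a kernel vector, which injectivity of `to` turns into a relation in `B`.
  independent⇒≤ : ∀ {n} (w : Fin n → B.Carrier) → Independent w → n ≤ t ℕ.* t ℕ.* δ
  independent⇒≤ {n} w w-independent = ℕ.≮⇒≥ λ m<n →
    kernel m<n (coordinate ∘ index) λ (x , (j , xⱼ≉0) , Ax≈0) →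
      xⱼ≉0 (w-independent x (injective (λ r s → begin
        to (x • w) r s
          ≈⟨ to-• x w r s ⟩
        sum (λ j → ι (x j) * to (w j) r s)
          ≈⟨ sum-cong-≋ {n} (λ j → *-congˡ (proj₂ (spanning (to (w j) r s)))) ⟩
        sum (λ j → ι (x j) * (λ l → coordinate ((r , s) , l) j) •ᴰ basis)
          ≈⟨ •ᴰ-kernel (λ l → coordinate ((r , s) , l)) x basis (λ l →
               ≡.subst (λ ρ → sumF (λ j → coordinate ρ j F.* x j) F.≈ F.0#)
                 (index-combine r s l) (Ax≈0 (combine (combine r s) l))) ⟩
        0#
          ≈⟨ sym (0#-homo r s) ⟩
        to B.0# r s ∎)) j)
    where
    coordinate : (Fin t × Fin t) × Fin δ → Fin n → F.Carrier
    coordinate ((r , s) , l) j = proj₁ (spanning (to (w j) r s)) l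

  elementary : Fin t → Fin t → Carrier → B.Carrier
  elementary r s x = proj₁ (surjective λ i j →
    if ⌊ r Fin.≟ i ⌋ then (if ⌊ s Fin.≟ j ⌋ then x else 0#) else 0#)

  to-elementary : ∀ r s x i j → to (elementary r s x) i j ≈
                  (if ⌊ r Fin.≟ i ⌋ then (if ⌊ s Fin.≟ j ⌋ then x else 0#) else 0#)
  to-elementary r s x = proj₂ (surjective _) B.refl

  elementary-* : ∀ r s x b j → to (elementary r s x B.* b) r j ≈ x * to b s j
  elementary-* r s x b j = begin
    to (elementary r s x B.* b) r j
      ≈⟨ *-homo _ _ r j ⟩
    sum (λ k → to (elementary r s x) r k * to b k j)
      ≈⟨ sum-single s _ (λ k k≢s → trans
           (*-congʳ (trans (to-elementary r s x r k)
             (reflexive (≡.trans (if-≟-yes r) (if-≟-no (k≢s ∘ ≡.sym)))))) (zeroˡ _)) ⟩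
    to (elementary r s x) r s * to b s j
      ≈⟨ *-congʳ (trans (to-elementary r s x r s) (reflexive (≡.trans (if-≟-yes r) (if-≟-yes s)))) ⟩
    x * to b s j ∎

  elementary-*-≈0 : ∀ {r i} s x b j → r ≢ i → to (elementary r s x B.* b) i j ≈ 0#
  elementary-*-≈0 {r} {i} s x b j r≢i = trans (*-homo _ _ i j) (sum-zero {t} _ λ k →
    trans (*-congʳ (trans (to-elementary r s x i k) (reflexive (if-≟-no r≢i)))) (zeroˡ _))

  -- In Mₜ(D) e, left multiples of a nonzero row of e fill each of the t rows
  -- independently with a copy of D.
  leftIdeal-≤ : IsDivisionRing ring → ∀ e → ¬ (e B.≈ B.0#) →
                ∀ {m} (v : Fin m → B.Carrier) → (∀ b → ∃[ x ] b B.* e B.≈ x • v) → t ℕ.* δ ≤ m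
  leftIdeal-≤ D-division e e≉0 {m} v Be-spanned = ℕ.≮⇒≥ λ m<tδ →
    ¬∀⇒¬¬∃¬ (λ e≈0 → e≉0 (injective (λ r s → trans (e≈0 r s) (sym (0#-homo r s))))) λ (r , eᵣ≉0) →
    ¬∀⇒¬¬∃¬ eᵣ≉0 λ (s , eᵣₛ≉0) →
    ℕ.<⇒≱ m<tδ (steinitz (w r) (w-independent r s eᵣₛ≉0) v (λ _ → Be-spanned _))
    where
    open IsDivisionRing D-division

    -- The pair `(i , l)` stands for row `r` of `e`, multiplied on the left by `basis l` and placed
    -- in row `i`.
    w : Fin t → Fin (t ℕ.* δ) → B.Carrier
    w r k = let i , l = remQuot {t} δ k in elementary i r (basis l) B.* e

    w-combine : ∀ r i l → w r (combine i l) ≡ elementary i r (basis l) B.* e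
    w-combine r i l = ≡.cong (λ (i , l) → elementary i r (basis l) B.* e) (Fin.remQuot-combine {t} {δ} i l)

    -- Entry `(i , s)` of a relation sees only the elements placed in row `i` and says
    -- `y * to e r s ≈ 0#`. Cancelling the nonzero entry leaves a relation among the basis of `D`.
    w-independent : ∀ r s → ¬ (to e r s ≈ 0#) → Independent (w r)
    w-independent r s eᵣₛ≉0 x xw≈0 k =
      F.trans (F.reflexive (≡.cong x (≡.sym (Fin.combine-remQuot {t} δ k))))
        (independent (λ l → x (combine {t} {δ} i l)) row≈0 (proj₂ (remQuot {t} δ k)))
      where
      i : Fin t
      i = proj₁ (remQuot {t} δ k)

      y : Carrier
      y = sum (λ l → ι (x (combine {t} {δ} i l)) * basis l)

      y*eᵣₛ≈0 : y * to e r s ≈ 0#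
      y*eᵣₛ≈0 = begin
        y * to e r s
          ≈⟨ *-distribʳ-sum {δ} _ _ ⟩
        sum (λ l → ι (x (combine {t} {δ} i l)) * basis l * to e r s)
          ≈⟨ sum-cong-≋ {δ} (λ l → trans (*-assoc _ _ _) (*-congˡ (sym (trans
               (reflexive (≡.cong (λ b → to b i s) (w-combine r i l))) (elementary-* i r (basis l) e s))))) ⟩
        sum (λ l → ι (x (combine {t} {δ} i l)) * to (w r (combine {t} {δ} i l)) i s)
          ≈⟨ sym (sum-single i
               (λ j → sum (λ l → ι (x (combine {t} {δ} j l)) * to (w r (combine {t} {δ} j l)) i s))
               (λ j j≢i → sum-zero {δ} _ (λ l → trans
                 (*-congˡ (trans
                   (reflexive (≡.cong (λ b → to b i s) (w-combine r j l)))
                   (elementary-*-≈0 r (basis l) e s j≢i)))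
                 (zeroʳ _)))) ⟩
        sum (λ j → sum (λ l → ι (x (combine {t} {δ} j l)) * to (w r (combine {t} {δ} j l)) i s))
          ≈⟨ sym (sum-combine t δ _) ⟩
        sum (λ j → ι (x j) * to (w r j) i s)
          ≈⟨ sym (to-• x (w r) i s) ⟩
        to (x • w r) i s
          ≈⟨ trans (⟦⟧-cong xw≈0 i s) (0#-homo i s) ⟩
        0# ∎

      row≈0 : y ≈ 0#
      row≈0 = let z , _ , eᵣₛ*z = invertible _ eᵣₛ≉0 in begin
        y                    ≈⟨ sym (*-identityʳ y) ⟩
        y * 1#               ≈⟨ *-congˡ (sym eᵣₛ*z) ⟩
        y * (to e r s * z)   ≈⟨ sym (*-assoc _ _ _) ⟩
        y * to e r s * z     ≈⟨ *-congʳ y*eᵣₛ≈0 ⟩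
        0# * z               ≈⟨ zeroˡ z ⟩
        0# ∎

-- Cyclic Galois extensions

-- Serves twice: to view `K` as an algebra over itself, and to have `F` as the bottom intermediate
-- field.
trivialExtension : (F : Field c ℓ) → Extension F F
trivialExtension F = record
  { ι                = λ x → x
  ; ι-isHomomorphism = Identity.isRingHomomorphism (Field.rawRing F) (Field.refl F)
  }

module Powers {F K : Field c ℓ} (K/F : Extension F K) (σ : Automorphism K/F) where
  open Field K
  open Extension K/F using (ι)
  open Automorphism
  open Endo Carrier using () renaming (_^_ to _^ᵉ_)

  infixr 9 σ^_
  σ^_ : ℕ → Carrier → Carrier
  σ^ k = map σ ^ᵉ k

  power : ℕ → Automorphism K/F
  power k = record { map = σ^ k ; isIsomorphism = iso k ; fixes = fix k }
    where
    iso : ∀ k → IsRingIsomorphism rawRing rawRing (σ^ k)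
    iso zero    = Identity.isRingIsomorphism rawRing refl
    iso (suc k) = Composition.isRingIsomorphism trans (iso k) (isIsomorphism σ)

    fix : ∀ k f → (σ^ k) (ι f) ≈ ι f
    fix zero    f = refl
    fix (suc k) f = trans (IsRingIsomorphism.⟦⟧-cong (isIsomorphism σ) (fix k f)) (fixes σ f)

  module Power k = IsRingIsomorphism (isIsomorphism (power k))

  σ^-+ : ∀ j k x → (σ^ (j ℕ.+ k)) x ≡ (σ^ j) ((σ^ k) x)
  σ^-+ zero    k x = ≡.refl
  σ^-+ (suc j) k x = ≡.cong (map σ) (σ^-+ j k x)

  -- Stated for a single `x`, so as to serve both for powers that are the identity on `K` and for
  -- powers that merely fix an intermediate field.
  fixed-* : ∀ {k x} → (σ^ k) x ≈ x → ∀ j → (σ^ (j ℕ.* k)) x ≈ x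
  fixed-* {k} {x} fixed zero    = refl
  fixed-* {k} {x} fixed (suc j) =
    trans (reflexive (σ^-+ k (j ℕ.* k) x)) (trans (Power.⟦⟧-cong k (fixed-* fixed j)) fixed)

  fixed-+* : ∀ {k x} → (σ^ k) x ≈ x → ∀ i j → (σ^ (i ℕ.+ j ℕ.* k)) x ≈ (σ^ i) x
  fixed-+* {k} {x} fixed i j = trans (reflexive (σ^-+ i (j ℕ.* k) x)) (Power.⟦⟧-cong i (fixed-* fixed j))

  fixed-% : ∀ {k x} .{{_ : NonZero k}} → (σ^ k) x ≈ x → ∀ j → (σ^ j) x ≈ (σ^ (j % k)) x
  fixed-% {k} {x} fixed j =
    trans (reflexive (≡.cong (λ i → (σ^ i) x) (m≡m%n+[m/n]*n j k))) (fixed-+* fixed (j % k) (j / k))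

  σ^-∸ : ∀ {i j x} → i ≤ j → (σ^ i) x ≈ (σ^ j) x → (σ^ (j ℕ.∸ i)) x ≈ x
  σ^-∸ {i} {j} {x} i≤j σⁱx≈σʲx = Power.injective i (begin
    (σ^ i) ((σ^ (j ℕ.∸ i)) x) ≡⟨ σ^-+ i (j ℕ.∸ i) x ⟨
    (σ^ (i ℕ.+ (j ℕ.∸ i))) x  ≡⟨ ≡.cong (λ k → (σ^ k) x) (ℕ.m+[n∸m]≡n i≤j) ⟩
    (σ^ j) x                  ≈⟨ σⁱx≈σʲx ⟨
    (σ^ i) x                  ∎)
    where open SetoidReasoning setoid

module CyclicGalois {F K : Field c ℓ} (K/F : Extension F K)
                    {N} .{{N≢0 : NonZero N}} (gal : GalEnumeration K/F N)
                    (σ : Automorphism K/F) (σ-generates : Generates K/F σ) where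
  open Field K hiding (zero)
  open Extension K/F using (ι)
  open Automorphism
  open Powers K/F σ
  private module Galᴷ = Bijection gal

  -- If `σ^ k` were the identity, each of the `N` automorphisms would equal one of `k < N` powers of
  -- `σ`, and two of them would coincide.
  order-minimal : ∀ {k} → 0 < k → k < N → ¬ (∀ x → (σ^ k) x ≈ x)
  order-minimal {suc k} _ k<N σᵏ≈id =
    let i , j , i<j , fᵢ≡fⱼ = Fin.pigeonhole k<N exponent in
    Fin.<⇒≢ i<j (Galᴷ.injective λ x → begin
      map (Galᴷ.to i) x             ≈⟨ exponent-correct i x ⟩
      (σ^ (toℕ (exponent i))) x     ≡⟨ ≡.cong (λ r → (σ^ (toℕ r)) x) fᵢ≡fⱼ ⟩
      (σ^ (toℕ (exponent j))) x     ≈⟨ exponent-correct j x ⟨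
      map (Galᴷ.to j) x             ∎)
    where
    open SetoidReasoning setoid

    exponent : Fin N → Fin (suc k)
    exponent i = fromℕ< (m%n<n (proj₁ (σ-generates (Galᴷ.to i))) (suc k))

    exponent-correct : ∀ i x → map (Galᴷ.to i) x ≈ (σ^ (toℕ (exponent i))) x
    exponent-correct i x = let r , τ≈σʳ = σ-generates (Galᴷ.to i) in begin
      map (Galᴷ.to i) x               ≈⟨ τ≈σʳ x ⟩
      (σ^ r) x                        ≈⟨ fixed-% {suc k} (σᵏ≈id x) r ⟩
      (σ^ (r % suc k)) x              ≡⟨ ≡.cong (λ r → (σ^ r) x) (Fin.toℕ-fromℕ< (m%n<n r (suc k))) ⟨
      (σ^ (toℕ (exponent i))) x       ∎

  -- Among the powers with exponents from 0 to `N` two coincide. Their exponents differ by at most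
  -- `N`, and by `order-minimal` not by less.
  order : ∀ x → (σ^ N) x ≈ x
  order x = ≡.subst (λ k → (σ^ k) x ≈ x) N≡ (σ^-∸ {toℕ i} {toℕ j} (ℕ.<⇒≤ i<j) (σⁱ≈σʲ x))
    where
    open SetoidReasoning setoid

    σ-index : Fin (suc N) → Fin N
    σ-index i = proj₁ (Galᴷ.surjective (power (toℕ i)))

    collision = Fin.pigeonhole (ℕ.n<1+n N) σ-index
    i = proj₁ collision
    j = proj₁ (proj₂ collision)
    i<j = proj₁ (proj₂ (proj₂ collision))

    σⁱ≈σʲ : ∀ x → (σ^ (toℕ i)) x ≈ (σ^ (toℕ j)) x
    σⁱ≈σʲ x = begin
      (σ^ (toℕ i)) x              ≈⟨ proj₂ (Galᴷ.surjective (power (toℕ i))) ≡.refl x ⟨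
      map (Galᴷ.to (σ-index i)) x ≡⟨ ≡.cong (λ k → map (Galᴷ.to k) x) (proj₂ (proj₂ (proj₂ collision))) ⟩
      map (Galᴷ.to (σ-index j)) x ≈⟨ proj₂ (Galᴷ.surjective (power (toℕ j))) ≡.refl x ⟩
      (σ^ (toℕ j)) x              ∎

    N≡ : toℕ j ℕ.∸ toℕ i ≡ N
    N≡ = ℕ.≤-antisym
      (ℕ.≤-trans (ℕ.m∸n≤m (toℕ j) (toℕ i)) (ℕ.≤-pred (Fin.toℕ<n j)))
      (ℕ.≮⇒≥ λ k<N → order-minimal (ℕ.m<n⇒0<n∸m i<j) k<N
        λ x → σ^-∸ {toℕ i} {toℕ j} (ℕ.<⇒≤ i<j) (σⁱ≈σʲ x))

  σ^-injective : ∀ {j k} → j < N → k < N → (∀ x → (σ^ j) x ≈ (σ^ k) x) → j ≡ k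
  σ^-injective {j} {k} j<N k<N σʲ≈σᵏ with ℕ.<-cmp j k
  ... | tri≈ _ j≡k _ = j≡k
  ... | tri< j<k _ _ = contradiction (λ x → σ^-∸ (ℕ.<⇒≤ j<k) (σʲ≈σᵏ x))
    (order-minimal (ℕ.m<n⇒0<n∸m j<k) (ℕ.≤-<-trans (ℕ.m∸n≤m k j) k<N))
  ... | tri> _ _ k<j = contradiction (λ x → σ^-∸ (ℕ.<⇒≤ k<j) (sym (σʲ≈σᵏ x)))
    (order-minimal (ℕ.m<n⇒0<n∸m k<j) (ℕ.≤-<-trans (ℕ.m∸n≤m j k) j<N))

  -- The stabiliser of an intermediate field

  module Subextension (M : IntermediateField K/F) where
    open IntermediateField M
    private
      module L = Field L
      module Lower = Extension lower
      module Upper = Extension upper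
      module ι↑ = IsRingHomomorphism Upper.ι-isHomomorphism
      ι↑ = Upper.ι

    Fixes : ℕ → Set (c ⊔ ℓ)
    Fixes k = ∀ z → (σ^ k) (ι↑ z) ≈ ι↑ z

    -- Since Gal(K/F) is cyclic, the least positive exponent that fixes `L` is the index of the
    -- subgroup Gal(K/L).
    IsIndexOfStabiliser : ℕ → Set (c ⊔ ℓ)
    IsIndexOfStabiliser q = 0 < q × Fixes q × (∀ k → 0 < k → k < q → ¬ Fixes k)

    -- The exponent `N` fixes `L`, and a nonempty set of numbers has a least element up to double
    -- negation: without one, strong induction excludes every positive exponent.
    stabiliser-index : ¬ ¬ ∃ IsIndexOfStabiliser
    stabiliser-index ¬∃ =
      <-rec (λ k → 0 < k → ¬ Fixes k)
        (λ k rec 0<k fixes → ¬∃ (k , 0<k , fixes , λ j 0<j j<k → rec j<k 0<j))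
        N (ℕ.>-nonZero⁻¹ N) (order ∘ ι↑)

    module Stabiliser {q} (index : IsIndexOfStabiliser q) where
      fixes-q : Fixes q
      fixes-q = proj₁ (proj₂ index)

      instance
        q≢0 : NonZero q
        q≢0 = ℕ.>-nonZero (proj₁ index)

      minimal : ∀ k → 0 < k → k < q → ¬ Fixes k
      minimal = proj₂ (proj₂ index)

      -- The remainder `k % q` fixes `L` as well, so minimality of `q` makes it zero.
      fixes⇒∣ : ∀ {k} → Fixes k → q ∣ k
      fixes⇒∣ {k} fixes-k = m%n≡0⇒n∣m k q (ℕ.n≤0⇒n≡0 (ℕ.≮⇒≥ λ 0<k%q →
        minimal (k % q) 0<k%q (m%n<n k q) λ z → trans (sym (fixed-% {q} (fixes-q z) k)) (fixes-k z)))

      χ : Fin q → L.Carrier → Carrier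
      χ i z = (σ^ (toℕ i)) (ι↑ z)

      open Dedekind K L._*_ L.1# using (IsCharacter; Distinct; characters-independent)

      χ-isCharacter : ∀ i → IsCharacter (χ i)
      χ-isCharacter i = record
        { ·-homo = λ y z → trans (Power.⟦⟧-cong k (ι↑.*-homo y z)) (Power.*-homo k _ _)
        ; 1-homo = trans (Power.⟦⟧-cong k ι↑.1#-homo) (Power.1#-homo k)
        }
        where k = toℕ i

      module _ {D} (L-basis : HasDegree lower D) where
        open HasDimension L-basis
        open SemiringSum semiring
        open CommutativeMonoidSum L.+-commutativeMonoid using () renaming (sum to sumL)
        open SetoidReasoning setoid

        coordinates : L.Carrier → Fin D → Carrier
        coordinates z l = ι (proj₁ (spanning z) l)

        -- Powers of `σ` fix `F`, so `χ i` is F-linear and determined by its values on the basis of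
        -- `L`.
        χ-linear : ∀ i z → χ i z ≈ sum (λ l → χ i (basis l) * coordinates z l)
        χ-linear i z = begin
          χ i z
            ≈⟨ χ-cong (proj₂ (spanning z)) ⟩
          χ i (sumL (λ l → Lower.ι (proj₁ (spanning z) l) L.* basis l))
            ≈⟨ sum-homo {M = L.+-commutativeMonoid} {N = +-commutativeMonoid} χ-additive {D} _ ⟩
          sum (λ l → χ i (Lower.ι (proj₁ (spanning z) l) L.* basis l))
            ≈⟨ sum-cong-≋ {D} (λ l → begin
              χ i (Lower.ι (proj₁ (spanning z) l) L.* basis l)
                ≈⟨ trans (IsCharacter.·-homo (χ-isCharacter i) _ _) (*-comm _ _) ⟩
              χ i (basis l) * χ i (Lower.ι (proj₁ (spanning z) l))
                ≈⟨ *-congˡ (trans (Power.⟦⟧-cong k (commutes _)) (fixes (power k) _)) ⟩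
              χ i (basis l) * coordinates z l ∎) ⟩
          sum (λ l → χ i (basis l) * coordinates z l) ∎
          where
          k = toℕ i

          χ-cong : ∀ {y z} → y L.≈ z → χ i y ≈ χ i z
          χ-cong = Power.⟦⟧-cong k ∘ ι↑.⟦⟧-cong

          χ-additive : IsMonoidHomomorphism L.+-rawMonoid +-rawMonoid (χ i)
          χ-additive = record
            { isMagmaHomomorphism = record
              { isRelHomomorphism = record { cong = χ-cong }
              ; homo = λ y z → trans (Power.⟦⟧-cong k (ι↑.+-homo y z)) (Power.+-homo k _ _)
              }
            ; ε-homo = trans (Power.⟦⟧-cong k ι↑.0#-homo) (Power.0#-homo k)
            }

        -- Linearity reduces agreement to finitely many basis elements, over which double negation
        -- can be moved outwards. Agreement of `χ i` and `χ j` would make the power by the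
        -- difference of the exponents fix `L`, against minimality of `q`.
        χ-distinct : Distinct χ
        χ-distinct i j i≢j χᵢ≈χⱼ = ¬¬-∀ (λ l → χᵢ≈χⱼ (basis l)) λ χᵢ≈χⱼ-basis →
          distinct λ z → begin
            χ i z                                        ≈⟨ χ-linear i z ⟩
            sum (λ l → χ i (basis l) * coordinates z l)  ≈⟨ sum-cong-≋ {D} (λ l → *-congʳ (χᵢ≈χⱼ-basis l)) ⟩
            sum (λ l → χ j (basis l) * coordinates z l)  ≈⟨ χ-linear j z ⟨
            χ j z                                        ∎
          where
          distinct : ¬ (∀ z → χ i z ≈ χ j z)
          distinct χᵢ≈χⱼ with ℕ.<-cmp (toℕ i) (toℕ j)
          ... | tri≈ _ i≡j _ = i≢j (Fin.toℕ-injective i≡j)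
          ... | tri< i<j _ _ = minimal _ (ℕ.m<n⇒0<n∸m i<j) (ℕ.≤-<-trans (ℕ.m∸n≤m _ (toℕ i)) (Fin.toℕ<n j))
            λ z → σ^-∸ {toℕ i} {toℕ j} (ℕ.<⇒≤ i<j) (χᵢ≈χⱼ z)
          ... | tri> _ _ j<i = minimal _ (ℕ.m<n⇒0<n∸m j<i) (ℕ.≤-<-trans (ℕ.m∸n≤m _ (toℕ j)) (Fin.toℕ<n i))
            λ z → σ^-∸ {toℕ j} {toℕ i} (ℕ.<⇒≤ j<i) (sym (χᵢ≈χⱼ z))

        -- If `D < q`, the values of the `q` embeddings on `D` basis elements form a matrix with a
        -- kernel vector, which is a linear relation among distinct characters.
        stabiliser-index-≤ : q ≤ D
        stabiliser-index-≤ = ℕ.≮⇒≥ λ D<q →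
          Kernel.kernel K D<q A λ (x , (i , xᵢ≉0) , Ax≈0) →
            characters-independent χ χ-isCharacter χ-distinct x
              (λ z → trans (sum-cong-≋ {q} (λ i → *-congˡ (χ-linear i z)))
                           (•-kernel A x (coordinates z) Ax≈0))
              i xᵢ≉0
          where
          -- The coefficients of this relation lie in `K`, hence the ground field `K`.
          open LinearAlgebra (Extension.algebra (trivialExtension K)) using (•-kernel)
          A : Fin D → Fin q → Carrier
          A l i = χ i (basis l)

      cofactor : ∃[ m ] N ≡ m ℕ.* q
      cofactor with fixes⇒∣ (order ∘ ι↑)
      ... | divides m N≡mq = m , N≡mq

      module _ {m} (N≡mq : N ≡ m ℕ.* q) {r} (gal↑ : GalEnumeration upper r) where
        private module Gal↑ = Bijection gal↑
        open CommutativeMonoidSum *-commutativeMonoid using ()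
          renaming (sum to product; sum-permute to product-permute; sum-cong-≋ to product-cong)
        open SetoidReasoning setoid

        lift : Automorphism upper → Automorphism K/F
        lift τ = record
          { map           = map τ
          ; isIsomorphism = isIsomorphism τ
          ; fixes         = λ f → trans (IsRingIsomorphism.⟦⟧-cong (isIsomorphism τ) (sym (commutes f)))
                                        (trans (fixes τ _) (commutes f))
          }

        descend : ℕ → Automorphism upper
        descend j = record
          { map           = σ^ (j ℕ.* q)
          ; isIsomorphism = isIsomorphism (power (j ℕ.* q))
          ; fixes         = λ z → fixed-* (fixes-q z) j
          }

        -- As an automorphism over `F`, `τ` is some `σ^ k`; it fixes `L`, so `q` divides `k`. The
        -- quotient matters only modulo `m`, because `σ^ (m ℕ.* q)` is the identity.
        descend-surjective : ∀ τ → ∃[ j ] (j < m × (∀ x → map τ x ≈ (σ^ (j ℕ.* q)) x))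
        descend-surjective τ with σ-generates (lift τ)
        ... | k , τ≈σᵏ with fixes⇒∣ {k} (λ z → trans (sym (τ≈σᵏ _)) (fixes τ z))
        ... | divides h ≡.refl = h % m , m%n<n h m , λ x → begin
          map τ x
            ≈⟨ τ≈σᵏ x ⟩
          (σ^ (h ℕ.* q)) x
            ≡⟨ ≡.cong (λ k → (σ^ k) x) hq≡ ⟩
          (σ^ (h % m ℕ.* q ℕ.+ h / m ℕ.* N)) x
            ≈⟨ fixed-+* (order x) (h % m ℕ.* q) (h / m) ⟩
          (σ^ (h % m ℕ.* q)) x ∎
          where
          instance
            m≢0 : NonZero m
            m≢0 = ℕ.m*n≢0⇒m≢0 m {q} {{≡.subst NonZero N≡mq N≢0}}
          hq≡ : h ℕ.* q ≡ h % m ℕ.* q ℕ.+ h / m ℕ.* N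
          hq≡ = ≡.trans (≡.cong (ℕ._* q) (m≡m%n+[m/n]*n h m))
            (≡.trans (ℕ.*-distribʳ-+ q (h % m) _)
              (≡.cong (h % m ℕ.* q ℕ.+_) (≡.trans (ℕ.*-assoc (h / m) m q) (≡.cong (h / m ℕ.*_) (≡.sym N≡mq)))))

        -- The given enumeration and the powers with exponents `j * q`, `j < m`, list the same group
        -- without repetition, so they differ by a permutation.
        reindex : Permutation m r
        reindex = permutation to from to-from from-to
          where
          to : Fin m → Fin r
          to j = proj₁ (Gal↑.surjective (descend (toℕ j)))

          to-correct : ∀ j x → map (Gal↑.to (to j)) x ≈ (σ^ (toℕ j ℕ.* q)) x
          to-correct j = proj₂ (Gal↑.surjective (descend (toℕ j))) ≡.refl

          from : Fin r → Fin m
          from i = fromℕ< (proj₁ (proj₂ (descend-surjective (Gal↑.to i))))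

          from-correct : ∀ i x → map (Gal↑.to i) x ≈ (σ^ (toℕ (from i) ℕ.* q)) x
          from-correct i x = let j , j<m , τ≈σʲ = descend-surjective (Gal↑.to i) in
            trans (τ≈σʲ x) (reflexive (≡.cong (λ k → (σ^ (k ℕ.* q)) x) (≡.sym (Fin.toℕ-fromℕ< j<m))))

          to-from : ∀ i → to (from i) ≡ i
          to-from i = Gal↑.injective λ x → trans (to-correct (from i) x) (sym (from-correct i x))

          <N : ∀ (j : Fin m) → toℕ j ℕ.* q < N
          <N j = ≡.subst (toℕ j ℕ.* q <_) (≡.sym N≡mq) (ℕ.*-monoˡ-< q (Fin.toℕ<n j))

          from-to : ∀ j → from (to j) ≡ j
          from-to j = Fin.toℕ-injective (ℕ.*-cancelʳ-≡ _ _ q (σ^-injective (<N (from (to j))) (<N j) λ x →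
            trans (sym (from-correct (to j) x)) (to-correct j x)))

        norm-product : ∀ x → norm upper gal↑ x ≈ product {m} (λ j → (σ^ (toℕ j ℕ.* q)) x)
        norm-product x = begin
          norm upper gal↑ x
            ≈⟨ product-permute {m} {r} _ reindex ⟩
          product {m} (λ j → map (Gal↑.to (proj₁ (Gal↑.surjective (descend (toℕ j))))) x)
            ≈⟨ product-cong {m} (λ j → proj₂ (Gal↑.surjective (descend (toℕ j))) ≡.refl x) ⟩
          product {m} (λ j → (σ^ (toℕ j ℕ.* q)) x) ∎

-- Cyclic algebras

module Cyclic {F K : Field c ℓ} (K/F : Extension F K) {N} (K-basis : HasDegree K/F N)
              (σ : Automorphism K/F) {ξ} (A : CyclicAlgebra K/F N σ ξ) where
  private
    module F = Field F
    module K = Field K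
    module K/F = Extension K/F
    module K-basis = HasDimension K-basis
  open CyclicAlgebra A hiding (zero)
  open RawSemiringDefinitions (Semiring.rawSemiring semiring) using () renaming (_^_ to _^ᴬ_)
  open SemiringExp semiring using (^-homo-*; ^-congʳ)
  open SemiringSum semiring
  open Sums +-commutativeMonoid
  open SetoidReasoning setoid
  open LinearAlgebra algebra
  open LinearAlgebra K/F.algebra using () renaming (_•_ to _•ᴷ_)
  open IsRingHomomorphism κ-isHomomorphism
    renaming (⟦⟧-cong to κ-cong; +-homo to κ-+; *-homo to κ-*; 0#-homo to κ-0; 1#-homo to κ-1)
  open Powers K/F σ
  open GroupProperties +-group using () renaming (∙-cancelʳ to +-cancelʳ)
  open CommutativeMonoidSum K.*-commutativeMonoid using ()
    renaming (sum to product; sum-cong-≋ to product-cong; sum-init-last to product-init-last)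

  κ-u : ∀ d → κ d * u ≈ u * κ (Automorphism.map σ d)
  κ-u d = begin
    κ d * u                 ≈⟨ sym (*-identityˡ _) ⟩
    1# * (κ d * u)          ≈⟨ *-congʳ (sym u*u⁻¹) ⟩
    u * u⁻¹ * (κ d * u)     ≈⟨ *-assoc _ _ _ ⟩
    u * (u⁻¹ * (κ d * u))   ≈⟨ *-congˡ (trans (sym (*-assoc _ _ _)) (conjugation d)) ⟩
    u * κ (Automorphism.map σ d) ∎

  κ-u^ : ∀ k d → κ d * u ^ᴬ k ≈ u ^ᴬ k * κ ((σ^ k) d)
  κ-u^ zero    d = trans (*-identityʳ _) (sym (*-identityˡ _))
  κ-u^ (suc k) d = begin
    κ d * (u * u ^ᴬ k)                        ≈⟨ sym (*-assoc _ _ _) ⟩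
    κ d * u * u ^ᴬ k                          ≈⟨ *-congʳ (κ-u d) ⟩
    u * κ (Automorphism.map σ d) * u ^ᴬ k      ≈⟨ *-assoc _ _ _ ⟩
    u * (κ (Automorphism.map σ d) * u ^ᴬ k)    ≈⟨ *-congˡ (κ-u^ k _) ⟩
    u * (u ^ᴬ k * κ ((σ^ k) ((σ^ 1) d)))       ≈⟨ sym (*-assoc _ _ _) ⟩
    -- `σ^ suc k` unfolds with the extra `σ` outermost, while here it is innermost; both agree by
    -- additivity of exponents.
    u * u ^ᴬ k * κ ((σ^ k) ((σ^ 1) d))         ≡⟨ ≡.cong (λ y → u * u ^ᴬ k * κ y) (σ^-+ k 1 d) ⟨
    u * u ^ᴬ k * κ ((σ^ (k ℕ.+ 1)) d)          ≡⟨ ≡.cong (λ i → u * u ^ᴬ k * κ ((σ^ i) d)) (ℕ.+-comm k 1) ⟩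
    u * u ^ᴬ k * κ ((σ^ suc k) d)              ∎

  -- With `N` coefficients this is the normal form of elements of the algebra; with `q` coefficients
  -- it gives the multipliers that suffice for the left ideal below.
  poly : ∀ {n} → (Fin n → K.Carrier) → Carrier
  poly d = sum (λ j → u ^ᴬ toℕ j * κ (d j))

  poly-+ : ∀ {n} (d d′ : Fin n → K.Carrier) → poly (λ j → d j K.+ d′ j) ≈ poly d + poly d′
  poly-+ {n} d d′ = trans (sum-cong-≋ {n} λ j → trans (*-congˡ (κ-+ _ _)) (distribˡ _ _ _)) (∑-distrib-+ {n} _ _)

  poly-*κ : ∀ {n} (d : Fin n → K.Carrier) y → poly (λ j → d j K.* y) ≈ poly d * κ y
  poly-*κ {n} d y = trans (sum-cong-≋ {n} λ j → trans (*-congˡ (κ-* _ _)) (sym (*-assoc _ _ _)))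
                          (sym (*-distribʳ-sum {n} _ _))

  δ : ∀ {n} → Fin n → K.Carrier → Fin n → K.Carrier
  δ k y j = if ⌊ k Fin.≟ j ⌋ then y else K.0#

  poly-0 : ∀ {n} (d : Fin n → K.Carrier) → (∀ j → d j K.≈ K.0#) → poly d ≈ 0#
  poly-0 {n} d d≈0 = sum-zero {n} _ λ j → trans (*-congˡ (trans (κ-cong (d≈0 j)) κ-0)) (zeroʳ _)

  poly-δ : ∀ {n} (k : Fin n) y → poly (δ k y) ≈ u ^ᴬ toℕ k * κ y
  poly-δ {n} k y = trans
    (sum-single k _ λ j j≢k → trans
      (*-congˡ (trans (κ-cong (K.reflexive (if-≟-no (j≢k ∘ ≡.sym)))) κ-0)) (zeroʳ _))
    (*-congˡ (κ-cong (K.reflexive (if-≟-yes k))))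

  grid : ∀ n → Fin (n ℕ.* N) → Carrier
  grid n k = let j , i = remQuot {n} N k in u ^ᴬ toℕ j * κ (K-basis.basis i)

  κ-• : ∀ (x : Fin N → F.Carrier) a →
        a * κ (x •ᴷ K-basis.basis) ≈ sum (λ i → ι (x i) * (a * κ (K-basis.basis i)))
  κ-• x a = begin
    a * κ (x •ᴷ K-basis.basis)
      ≈⟨ *-congˡ (sum-homo {M = K.+-commutativeMonoid} {N = +-commutativeMonoid} +-isMonoidHomomorphism {N} _) ⟩
    a * sum (λ i → κ (K/F.ι (x i) K.* K-basis.basis i))
      ≈⟨ *-distribˡ-sum {N} _ _ ⟩
    sum (λ i → a * κ (K/F.ι (x i) K.* K-basis.basis i))
      ≈⟨ sum-cong-≋ {N} (λ i → begin
        a * κ (K/F.ι (x i) K.* K-basis.basis i)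
          ≈⟨ *-congˡ (trans (κ-* _ _) (*-congʳ (κ-linear (x i)))) ⟩
        a * (ι (x i) * κ (K-basis.basis i))
          ≈⟨ trans (sym (*-assoc _ _ _)) (*-congʳ (sym (ι-central _ _))) ⟩
        ι (x i) * a * κ (K-basis.basis i)
          ≈⟨ *-assoc _ _ _ ⟩
        ι (x i) * (a * κ (K-basis.basis i)) ∎) ⟩
    sum (λ i → ι (x i) * (a * κ (K-basis.basis i))) ∎

  grid-• : ∀ n (x : Fin (n ℕ.* N) → F.Carrier) →
           x • grid n ≈ poly {n} (λ j → (λ i → x (combine {n} {N} j i)) •ᴷ K-basis.basis)
  grid-• n x = begin
    x • grid n
      ≈⟨ sum-combine n N _ ⟩
    sum (λ j → sum (λ i → ι (x (combine {n} {N} j i)) * grid n (combine {n} {N} j i)))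
      ≈⟨ sum-cong-≋ {n} (λ j → trans
           (sum-cong-≋ {N} (λ i → *-congˡ (reflexive
             (≡.cong (λ (j , i) → u ^ᴬ toℕ j * κ (K-basis.basis i)) (Fin.remQuot-combine {n} {N} j i)))))
           (sym (κ-• (λ i → x (combine {n} {N} j i)) (u ^ᴬ toℕ j)))) ⟩
    poly {n} (λ j → (λ i → x (combine {n} {N} j i)) •ᴷ K-basis.basis) ∎

  -- Independence holds in two layers: powers of `u` over `K`, then the basis of `K` over `F`. It
  -- supplies the lower bound `N * N` for the dimension of the algebra.
  grid-independent : Independent (grid N)
  grid-independent x x•grid≈0 k =
    F.trans (F.reflexive (≡.cong x (≡.sym (Fin.combine-remQuot {N} N k))))
      (K-basis.independent _ (independent _ (trans (sym (grid-• N x)) x•grid≈0) j) i)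
    where
    j = proj₁ (remQuot {N} N k)
    i = proj₂ (remQuot {N} N k)

  -- The left ideal attached to a norm

  module NormElement (m q : ℕ) .{{_ : NonZero m}} .{{_ : NonZero q}} (N≡mq : N ≡ m ℕ.* q)
                     (x : K.Carrier) (norm≈ξ : K/F.ι ξ K.≈ product {m} (λ j → (σ^ (toℕ j ℕ.* q)) x)) where

    -- partialSum k = Σ_{j<k} vʲ κ(τʲ⁺¹x ⋯ τᵏ⁻¹x), where τ = σ^q and v = u^q.
    partialSum : ℕ → Carrier
    partialSum zero    = 0#
    partialSum (suc k) = partialSum k * κ ((σ^ (k ℕ.* q)) x) + u ^ᴬ (k ℕ.* q)

    partialNorm : ℕ → K.Carrier
    partialNorm k = product {k} (λ j → (σ^ (toℕ j ℕ.* q)) x)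

    partialNorm-suc : ∀ k → partialNorm (suc k) K.≈ partialNorm k K.* (σ^ (k ℕ.* q)) x
    partialNorm-suc k = K.trans (product-init-last {k} λ j → (σ^ (toℕ j ℕ.* q)) x) (K.*-cong
      (product-cong {k} λ j → K.reflexive (≡.cong (λ i → (σ^ (i ℕ.* q)) x) (Fin.toℕ-inject₁ j)))
      (K.reflexive (≡.cong (λ i → (σ^ (i ℕ.* q)) x) (Fin.toℕ-fromℕ k))))

    -- With v = `u ^ᴬ q`, this is (x - v) `partialSum k` = `partialNorm k` - vᵏ, written without
    -- subtraction. The inductive step moves `x` past vᵏ, which turns it into the next conjugate.
    telescope : ∀ k → κ x * partialSum k + u ^ᴬ (k ℕ.* q) ≈ u ^ᴬ q * partialSum k + κ (partialNorm k)
    telescope zero = +-cong (trans (zeroʳ _) (sym (zeroʳ _))) (sym κ-1)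
    telescope (suc k) = begin
      κ x * (s * y + w) + u ^ᴬ (q ℕ.+ k ℕ.* q)
        ≈⟨ +-cong (trans (distribˡ _ _ _) (+-cong (sym (*-assoc _ _ _)) (κ-u^ (k ℕ.* q) x))) (^-homo-* u q _) ⟩
      κ x * s * y + w * y + v * w
        ≈⟨ +-congʳ (sym (distribʳ _ _ _)) ⟩
      (κ x * s + w) * y + v * w
        ≈⟨ +-congʳ (*-congʳ (telescope k)) ⟩
      (v * s + κ (partialNorm k)) * y + v * w
        ≈⟨ +-congʳ (distribʳ _ _ _) ⟩
      v * s * y + κ (partialNorm k) * y + v * w
        ≈⟨ trans (+-assoc _ _ _) (trans (+-congˡ (+-comm _ _)) (sym (+-assoc _ _ _))) ⟩
      v * s * y + v * w + κ (partialNorm k) * y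
        ≈⟨ +-cong (trans (+-congʳ (*-assoc _ _ _)) (sym (distribˡ _ _ _)))
                  (trans (sym (κ-* _ _)) (κ-cong (K.sym (partialNorm-suc k)))) ⟩
      v * (s * y + w) + κ (partialNorm (suc k)) ∎
      where
      s = partialSum k
      v = u ^ᴬ q
      w = u ^ᴬ (k ℕ.* q)
      y = κ ((σ^ (k ℕ.* q)) x)

    e : Carrier
    e = partialSum m

    -- At `k = m` both remaining terms of `telescope` equal `ξ`: one by `u^r`, the other by the norm
    -- condition.
    u^q*e : u ^ᴬ q * e ≈ κ x * e
    u^q*e = sym (+-cancelʳ (ι ξ) _ _ (begin
      κ x * e + ι ξ                     ≈⟨ +-congˡ (sym u^r) ⟩
      κ x * e + u ^ᴬ N                  ≡⟨ ≡.cong (λ k → κ x * e + u ^ᴬ k) N≡mq ⟩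
      κ x * e + u ^ᴬ (m ℕ.* q)          ≈⟨ telescope m ⟩
      u ^ᴬ q * e + κ (partialNorm m)    ≈⟨ +-congˡ (trans (κ-cong (K.sym norm≈ξ)) (κ-linear ξ)) ⟩
      u ^ᴬ q * e + ι ξ                  ∎))

    -- Proved together with `partialSum-suc`. `partialSum k` involves only exponents `j * q` with
    -- `j < k`, so the power added next meets a zero coefficient and becomes the leading term, with
    -- coefficient 1.
    partialSum-coefficients : ∀ k → k ≤ m → ∃[ d ] (partialSum k ≈ poly {N} d) ×
                              (∀ j → k ℕ.* q ≤ toℕ j → d j K.≈ K.0#)
    partialSum-suc : ∀ k → k < m → ∃[ d ] (partialSum (suc k) ≈ poly {N} d) ×
           (∀ j → k ℕ.* q < toℕ j → d j K.≈ K.0#) × (∀ j → k ℕ.* q ≡ toℕ j → d j K.≈ K.1#)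

    partialSum-coefficients zero    _ = (λ _ → K.0#) , sym (poly-0 {N} _ (λ _ → K.refl)) , λ _ _ → K.refl
    partialSum-coefficients (suc k) k<m =
      let d , eq , vanish , _ = partialSum-suc k k<m in
      d , eq , λ j k<j → vanish j (ℕ.<-≤-trans (ℕ.m<n+m (k ℕ.* q) (ℕ.>-nonZero⁻¹ q)) k<j)

    partialSum-suc k k<m =
      let d , eq , vanish = partialSum-coefficients k (ℕ.<⇒≤ k<m) in
      (λ j → d j K.* y K.+ δ kq K.1# j) ,
      (begin
        partialSum k * κ y + u ^ᴬ (k ℕ.* q)
          ≈⟨ +-cong (*-congʳ eq) (trans (^-congʳ u (≡.sym kq≡)) (trans (sym (*-identityʳ _)) (*-congˡ (sym κ-1)))) ⟩
        poly d * κ y + u ^ᴬ toℕ kq * κ K.1#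
          ≈⟨ +-cong (sym (poly-*κ {N} d y)) (sym (poly-δ kq K.1#)) ⟩
        poly (λ j → d j K.* y) + poly (δ kq K.1#)
          ≈⟨ sym (poly-+ {N} _ _) ⟩
        poly (λ j → d j K.* y K.+ δ kq K.1# j) ∎) ,
      (λ j kq<j → K.trans (K.+-cong (K.trans (K.*-congʳ (vanish j (ℕ.<⇒≤ kq<j))) (K.zeroˡ y))
         (K.reflexive (if-≟-no λ kq≡j → ℕ.<⇒≢ kq<j (≡.trans (≡.sym kq≡) (≡.cong toℕ kq≡j))))) (K.+-identityˡ _)) ,
      (λ j kq≡j → K.trans (K.+-cong (K.trans (K.*-congʳ (vanish j (ℕ.≤-reflexive kq≡j))) (K.zeroˡ y))
         (K.reflexive (≡.trans (≡.cong (λ i → δ i K.1# j) (Fin.toℕ-injective (≡.trans kq≡ kq≡j))) (if-≟-yes j)))) (K.+-identityˡ _))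
      where
      y = (σ^ (k ℕ.* q)) x
      kq<N : k ℕ.* q < N
      kq<N = ≡.subst (k ℕ.* q <_) (≡.sym N≡mq) (ℕ.*-monoˡ-< q k<m)
      kq : Fin N
      kq = fromℕ< kq<N
      kq≡ : toℕ kq ≡ k ℕ.* q
      kq≡ = Fin.toℕ-fromℕ< kq<N

    e≉0 : ¬ (K.0# K.≈ K.1#) → ¬ (e ≈ 0#)
    -- The leading coefficient of `e`, at exponent `(m - 1) * q`, is 1; writing `m` as the successor
    -- of `ℕ.pred m` makes it accessible.
    e≉0 0≉1 e≈0 with d , eq , _ , leading ← partialSum-suc (ℕ.pred m) (ℕ.≤-reflexive (ℕ.suc-pred m)) =
      0≉1 (K.trans (K.sym (independent d (trans (sym (trans (reflexive (≡.cong partialSum (≡.sym (ℕ.suc-pred m)))) eq)) e≈0) k))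
                   (leading k (≡.sym (Fin.toℕ-fromℕ< k<N))))
      where
      k<N : ℕ.pred m ℕ.* q < N
      k<N = ≡.subst (ℕ.pred m ℕ.* q <_) (≡.sym N≡mq) (ℕ.*-monoˡ-< q (ℕ.≤-reflexive (ℕ.suc-pred m)))
      k : Fin N
      k = fromℕ< k<N

    -- Modulo the left annihilator of `e`, the multiplier `a` can be replaced by one of degree below
    -- `q` in `u`.
    Reducible : Carrier → Set (c ⊔ ℓ)
    Reducible a = ∃[ d ] a * e ≈ poly {q} d * e

    reducible-cong : ∀ {a b} → a * e ≈ b * e → Reducible b → Reducible a
    reducible-cong ae≈be (d , be≈de) = d , trans ae≈be be≈de

    reducible-+ : ∀ {a b} → Reducible a → Reducible b → Reducible (a + b)
    reducible-+ (d , ae≈de) (d′ , be≈d′e) = (λ j → d j K.+ d′ j) ,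
      trans (distribʳ _ _ _) (trans (+-cong ae≈de be≈d′e)
        (trans (sym (distribʳ _ _ _)) (*-congʳ (sym (poly-+ {q} d d′)))))

    reducible-sum : ∀ {n} (a : Fin n → Carrier) → (∀ j → Reducible (a j)) → Reducible (sum a)
    reducible-sum {zero}  a red = (λ _ → K.0#) , *-congʳ (sym (poly-0 {q} _ (λ _ → K.refl)))
    reducible-sum {suc n} a red = reducible-+ (red zero) (reducible-sum (a ∘ suc) (red ∘ suc))

    -- Strong induction on the exponent: while `k` is at least `q`, a factor `u ^ᴬ q` can be brought
    -- next to `e`, where it acts as `κ x`.
    reducible-monomial : ∀ k y → Reducible (u ^ᴬ k * κ y)
    reducible-monomial = <-rec (λ k → ∀ y → Reducible (u ^ᴬ k * κ y)) step
      where
      step : ∀ k → (∀ {j} → j < k → ∀ y → Reducible (u ^ᴬ j * κ y)) → ∀ y → Reducible (u ^ᴬ k * κ y)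
      step k rec y with k ℕ.<? q
      ... | yes k<q = δ (fromℕ< k<q) y , *-congʳ (trans
        (*-congʳ (^-congʳ u (≡.sym (Fin.toℕ-fromℕ< k<q)))) (sym (poly-δ (fromℕ< k<q) y)))
      ... | no k≮q =
        -- Writing `y` as the image of `z` allows `κ-u^` to move `u ^ᴬ q` to the right of the
        -- coefficient.
        let z , σ^qz≈y = Power.surjective q y in
        reducible-cong {b = u ^ᴬ (k ℕ.∸ q) * κ (z K.* x)} (begin
          u ^ᴬ k * κ y * e
            ≈⟨ *-congʳ (*-cong (trans (^-congʳ u (≡.sym (ℕ.m∸n+n≡m (ℕ.≮⇒≥ k≮q)))) (^-homo-* u (k ℕ.∸ q) q))
                               (κ-cong (K.sym (σ^qz≈y K.refl)))) ⟩
          u ^ᴬ (k ℕ.∸ q) * u ^ᴬ q * κ ((σ^ q) z) * e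
            ≈⟨ *-congʳ (trans (*-assoc _ _ _) (*-congˡ (sym (κ-u^ q z)))) ⟩
          u ^ᴬ (k ℕ.∸ q) * (κ z * u ^ᴬ q) * e
            ≈⟨ trans (*-assoc _ _ _) (*-congˡ (trans (*-assoc _ _ _) (*-congˡ u^q*e))) ⟩
          u ^ᴬ (k ℕ.∸ q) * (κ z * (κ x * e))
            ≈⟨ trans (*-congˡ (trans (sym (*-assoc _ _ _)) (*-congʳ (sym (κ-* z x))))) (sym (*-assoc _ _ _)) ⟩
          u ^ᴬ (k ℕ.∸ q) * κ (z K.* x) * e ∎)
          (rec (ℕ.∸-monoʳ-< (ℕ.>-nonZero⁻¹ q) (ℕ.≮⇒≥ k≮q)) (z K.* x))

    reducible : ∀ a → Reducible a
    reducible a = let d , a≈ = spanning a in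
      reducible-cong (*-congʳ a≈) (reducible-sum _ λ j → reducible-monomial (toℕ j) (d j))

    -- Expanding the `q` coefficients in the basis of `K` gives the `q * N` spanning elements
    -- required by `leftIdeal-≤`.
    leftIdeal-spanned : ∀ a → ∃[ y ] a * e ≈ y • (λ k → grid q k * e)
    leftIdeal-spanned a =
      let d , ae≈de = reducible a
          coordinate : Fin q → Fin N → F.Carrier
          coordinate j = proj₁ (K-basis.spanning (d j))
          y : Fin (q ℕ.* N) → F.Carrier
          y k = uncurry coordinate (remQuot {q} N k)
      in y , (begin
        a * e
          ≈⟨ ae≈de ⟩
        poly d * e
          ≈⟨ *-congʳ (sum-cong-≋ {q} λ j → *-congˡ (κ-cong (K.trans (proj₂ (K-basis.spanning (d j)))
               (•ᴷ-cong λ i → F.reflexive (≡.cong (uncurry coordinate) (≡.sym (Fin.remQuot-combine {q} {N} j i))))))) ⟩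
        poly {q} (λ j → (λ i → y (combine {q} {N} j i)) •ᴷ K-basis.basis) * e
          ≈⟨ *-congʳ (sym (grid-• q y)) ⟩
        (y • grid q) * e
          ≈⟨ *-distribʳ-sum {q ℕ.* N} _ _ ⟩
        sum (λ k → ι (y k) * grid q k * e)
          ≈⟨ sum-cong-≋ {q ℕ.* N} (λ k → *-assoc _ _ _) ⟩
        y • (λ k → grid q k * e) ∎)
      where
      •ᴷ-cong : ∀ {y z : Fin N → F.Carrier} → (∀ i → y i F.≈ z i) → y •ᴷ K-basis.basis K.≈ z •ᴷ K-basis.basis
      •ᴷ-cong y≈z = CommutativeMonoidSum.sum-cong-≋ K.+-commutativeMonoid {N} λ i →
        K.*-congʳ (IsRingHomomorphism.⟦⟧-cong K/F.ι-isHomomorphism (y≈z i))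

-- Comparing the index with the degree of an intermediate field

index-≤ : ∀ {t d q N} .{{_ : NonZero N}} →
          N ℕ.* N ≤ t ℕ.* t ℕ.* (d ℕ.* d) → t ℕ.* (d ℕ.* d) ≤ q ℕ.* N → d ≤ q
index-≤ {t} {d} {q} {N} N²≤ td²≤ = ℕ.*-cancelˡ-≤ N (begin
  N ℕ.* d          ≤⟨ ℕ.*-monoˡ-≤ d N≤td ⟩
  t ℕ.* d ℕ.* d    ≡⟨ ℕ.*-assoc t d d ⟩
  t ℕ.* (d ℕ.* d)  ≤⟨ td²≤ ⟩
  q ℕ.* N          ≡⟨ ℕ.*-comm q N ⟩
  N ℕ.* q          ∎)
  where
  open ℕ.≤-Reasoning
  -- The first hypothesis compares the squares of `N` and `t * d`.
  N≤td : N ≤ t ℕ.* d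
  N≤td = ℕ.≮⇒≥ λ td<N → ℕ.<⇒≱ (ℕ.*-mono-< td<N td<N)
    (ℕ.≤-trans N²≤ (ℕ.≤-reflexive (ℕ.[m*n]*[o*p]≡[m*o]*[n*p] t t d d)))

-- Treats any intermediate field to which `ξ` is a norm from `K`, so that both cases in the
-- definition of m(K/F) become instances.
index-≤-degree :
  ∀ {F K : Field c ℓ} (K/F : Extension F K) {N} .{{_ : NonZero N}} → IsGalois K/F N →
  ∀ σ → Generates K/F σ → ∀ {ξ} (A : CyclicAlgebra K/F N σ ξ) →
  (M : IntermediateField K/F) →
  ∀ {D} → HasDegree (IntermediateField.lower M) D →
  IsNorm (IntermediateField.upper M) (Extension.ι (IntermediateField.lower M) ξ) →
  ∀ {d} → IsIndex (CyclicAlgebra.algebra A) d → d ≤ D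
index-≤-degree {F = F} {K} K/F {N} K/F-galois σ σ-generates A M {D} L-degree
  (r , gal↑ , x , _ , ξ≈norm) {d} (t , E , A≃ME , E-division , E-basis) =
  decidable-stable (d ℕ.≤? D) λ d≰D →
  stabiliser-index λ (q , index) →
  let open Stabiliser index
      m , N≡mq = cofactor
      instance
        m≢0 : NonZero m
        m≢0 = ℕ.m*n≢0⇒m≢0 m {q} {{≡.subst NonZero N≡mq (ℕ.>-nonZero (ℕ.>-nonZero⁻¹ N))}}
      -- The norm condition concerns the image of `ξ` in `L`; `commutes` carries it to `F`, and
      -- `norm-product` rewrites the norm through powers of `σ`.
      open NormElement m q {{m≢0}} {{q≢0}} N≡mq x
        (K.trans (K.sym (commutes _)) (K.trans ξ≈norm (norm-product {m} N≡mq gal↑ x)))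
  in d≰D (ℕ.≤-trans
       (index-≤ {t} {d} {q} (independent⇒≤ (grid N) grid-independent)
          (leftIdeal-≤ E-division e (e≉0 (IsDivisionRing.0≉1 K.isDivisionRing)) _ leftIdeal-spanned))
       (stabiliser-index-≤ L-degree))
  where
  module K = Field K
  open IntermediateField M
  open IsGalois K/F-galois
  open CyclicGalois K/F enumeration σ σ-generates
  open Subextension M
  open Cyclic K/F degree σ A
  open MatrixAlgebra A≃ME E-basis

-- The bound in terms of m(K/F)

base : ∀ {F K : Field c ℓ} (K/F : Extension F K) → IntermediateField K/F
base {F = F} {K} K/F = record
  { L        = F
  ; lower    = trivialExtension F
  ; upper    = K/F
  ; commutes = λ _ → Field.refl K
  }

trivial-degree : (F : Field c ℓ) → HasDegree (trivialExtension F) 1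
trivial-degree F = record
  { basis       = λ _ → 1#
  ; spanning    = λ a → (λ _ → a) , sym (trans (+-identityʳ _) (*-identityʳ a))
  ; independent = λ k k≈0 → λ { zero → trans (sym (trans (+-identityʳ _) (*-identityʳ _))) k≈0 }
  }
  where open Field F hiding (zero)

mainTheorem3 : ∀ {c ℓ} (p n : ℕ) → Prime p → 1 ≤ n →
    {F K : Field c ℓ} (K/F : Extension F K) →
    IsGalois K/F (p ^ n) →
    ¬ HasCharacteristic F p →
    (ξ : Field.Carrier F) → IsPrimitiveRoot F p ξ →
    (σ : Automorphism K/F) → Generates K/F σ →
    (K⟨_⟩ : Fin (suc n) → IntermediateField K/F) →
    (∀ i → HasDegree (IntermediateField.lower K⟨ i ⟩) (p ^ toℕ i)) →
    (A : CyclicAlgebra K/F (p ^ n) σ ξ) →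
    ∀ m → Is-m K/F ξ K⟨_⟩ m →
    ∀ d → IsIndex (CyclicAlgebra.algebra A) d →
    d ≤ p ^[ m +1]
mainTheorem3 p n p-prime _ {F} K/F galois _ ξ _ σ σ-generates K⟨_⟩ K-degree A m is-m d is-index =
  bound m is-m
  where
  instance
    p≢0 : NonZero p
    p≢0 = prime⇒nonZero p-prime
    pⁿ≢0 : NonZero (p ^ n)
    pⁿ≢0 = ℕ.m^n≢0 p n

  bound : ∀ m → Is-m K/F ξ K⟨_⟩ m → d ≤ p ^[ m +1]
  -- Here `ξ` is a norm down to `F` itself, of degree 1; taking `base` instead of `K⟨ zero ⟩` avoids
  -- transporting the norm along an isomorphism.
  bound ⊥₋    ξ-norm = index-≤-degree K/F galois σ σ-generates A
    (base K/F) (trivial-degree F) ξ-norm is-index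
  -- The field `K⟨ s ⟩` has degree `p ^ s` over `F`, and `s` equals `m + 1`.
  bound [ m ] (_ , s , (ξ-norm , _) , s≡m+1) = ≡.subst (λ k → d ≤ p ^ k) s≡m+1
    (index-≤-degree K/F galois σ σ-generates A K⟨ s ⟩ (K-degree s) ξ-norm is-index)
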